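{- Let $L$ be a computable classical language, $\mathcal M$ a countable $L$-structure, and $\mathcal M^\#$ a computable presentation of $\mathcal M$; let $(\mathcal M^{[0,1)})^\#$ be the presentation of the Borel randomization induced by $\mathcal M^\#$. Then every quantifier-free $L$-formula $\varphi(\vec x)$ is computable with respect to $(\mathcal M^{[0,1)})^\#$. Moreover, an algorithm witnessing that $\varphi(\vec x)$ is computable with respect to $(\mathcal M^{[0,1)})^\#$ can be obtained from an algorithm witnessing that $\mathcal M^\#$ is a computable presentation of $\mathcal M$.
   Context: Borel randomization: $\mathcal M^{[0,1)}$ is the two-sorted continuous-logic metric structure with sorts $\mathcal K$ and $\mathcal B$. Sort $\mathcal K$ is the completion of the set of functions $f:[0,1)\to\mathcal M$ with $f^{ -1}(\{a\})$ Borel for every $a\in\mathcal M$, under $d(f,g)=\mu\{\omega: f(\omega)\ne g(\omega)\}$ ($\mu$ Lebesgue measure). Sort $\mathcal B$ is the measure algebra of Borel subsets of $[0,1)$ modulo null sets, with Boolean operations, predicate $\mu$, metric $\mu(A\triangle B)$. For each $L$-formula $\varphi(x_1,\dots,x_n)$ there is a function symbol $\llbracket\varphi\rrbracket:\mathcal K^n\to\mathcal B$ given on random variables by $\llbracket\varphi(f_1,\dots,f_n)\rrbracket=\{\omega:\mathcal M\models\varphi(f_1(\omega),\dots,f_n(\omega))\}$. A presentation of the classical structure $\mathcal M$ is a sequence of elements whose closure under function symbols (generated points, effectively enumerated as terms) is $\mathcal M$; it is computable if there is an algorithm deciding, for every atomic formula (including equality) and tuple of generated points, whether it holds in $\mathcal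 M$. The induced presentation $(\mathcal M^{[0,1)})^\#$ has as special (= generated, in sort $\mathcal K$) points all simple functions $\sum_{j=1}^n a_j\chi_{J_j}$ (equal to $a_j$ on $J_j$), with $a_j$ generated points of $\mathcal M^\#$ and $J_j$ pairwise disjoint finite Boolean combinations of intervals of $[0,1)$ with rational endpoints, effectively coded. An $L$-formula $\varphi(\vec x)$ is computable with respect to $(\mathcal M^{[0,1)})^\#$ if there is an algorithm which, given generated points $\vec f$ and rational $\epsilon>0$, returns a rational $q$ with $|\mu\llbracket\varphi(\vec f)\rrbracket-q|<\epsilon$. -}

module Defs where

open import Data.Nat using (ℕ; zero; suc)
open import Data.Fin using (Fin)
open import Data.Vec using (Vec; []; _∷_; lookup)
open import Data.List using (List; []; _∷_)
open import Data.Bool using (Bool; true; false; _∧_; _∨_; not; if_then_else_)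
open import Data.Product using (Σ; _×_; _,_; ∃)
open import Data.Sum using (_⊎_)
open import Data.Unit using (⊤)
open import Data.Empty using (⊥)
open import Data.Rational using (ℚ; 0ℚ; 1ℚ; _≤_; _<_; _-_; _≤ᵇ_; ∣_∣)
open import Relation.Nullary using (¬_; Dec)
open import Relation.Binary.PropositionalEquality using (_≡_)

record Language : Set₁ where
  field
    Fun    : Set
    Rel    : Set
    funAr  : Fun → ℕ
    relAr  : Rel → ℕ

module _ (L : Language) where
  open Language L

  data Term (V : Set) : Set where
    var : V → Term V
    app : (F : Fun) → Vec (Term V) (funAr F) → Term V

  data QF (n : ℕ) : Set where
    qtrue  : QF n
    qfalse : QF n
    eq     : Term (Fin n) → Term (Fin n) → QF n
    rel    : (R : Rel) → Vec (Term (Fin n)) (relAr R) → QF n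
    neg    : QF n → QF n
    conj   : QF n → QF n → QF n
    disj   : QF n → QF n → QF n
    impl   : QF n → QF n → QF n

  -- a (classical) L-structure; equality is propositional equality on Carrier
  record Structure : Set₁ where
    field
      Carrier : Set
      funI    : (F : Fun) → Vec Carrier (funAr F) → Carrier
      relI    : (R : Rel) → Vec Carrier (relAr R) → Set

module _ {L : Language} (M : Structure L) where
  open Language L
  open Structure M

  mutual
    evalT : {V : Set} → (V → Carrier) → Term L V → Carrier
    evalT ρ (var v)    = ρ v
    evalT ρ (app F ts) = funI F (evalTs ρ ts)

    evalTs : {V : Set} {k : ℕ} → (V → Carrier) → Vec (Term L V) k → Vec Carrier k
    evalTs ρ []       = []
    evalTs ρ (t ∷ ts) = evalT ρ t ∷ evalTs ρ ts

  Sat : {n : ℕ} → QF L n → (Fin n → Carrier) → Set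
  Sat qtrue      a = ⊤
  Sat qfalse     a = ⊥
  Sat (eq s t)   a = evalT a s ≡ evalT a t
  Sat (rel R ts) a = relI R (evalTs a ts)
  Sat (neg φ)    a = ¬ Sat φ a
  Sat (conj φ ψ) a = Sat φ a × Sat ψ a
  Sat (disj φ ψ) a = Sat φ a ⊎ Sat ψ a
  Sat (impl φ ψ) a = Sat φ a → Sat ψ a

  -- Generated points: closed terms built from the generators (indexed by ℕ)
  GTerm : Set
  GTerm = Term L ℕ

  record Presentation : Set where
    field
      gen        : ℕ → Carrier
      generating : (a : Carrier) → Σ GTerm (λ t → evalT gen t ≡ a)

  -- computability of a presentation: atomic formulas (incl. equality)
  -- on generated points are decidable (an Agda function = an algorithm)
  record Computable (P : Presentation) : Set where
    open Presentation P
    field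
      decEq  : (s t : GTerm) → Dec (evalT gen s ≡ evalT gen t)
      decRel : (R : Rel) (ts : Vec GTerm (relAr R)) → Dec (relI R (evalTs gen ts))

-- Finite Boolean combinations of rational intervals [p,q) of [0,1)

data Region : Set where
  ival  : ℚ → ℚ → Region
  rcomp : Region → Region         -- complement in [0,1)
  rinter : Region → Region → Region
  runion : Region → Region → Region

_∈ᵇ_ : ℚ → Region → Bool
ω ∈ᵇ ival p q     = (p ≤ᵇ ω) ∧ not (q ≤ᵇ ω)
ω ∈ᵇ rcomp J      = not (ω ∈ᵇ J)
ω ∈ᵇ rinter J K   = (ω ∈ᵇ J) ∧ (ω ∈ᵇ K)
ω ∈ᵇ runion J K   = (ω ∈ᵇ J) ∨ (ω ∈ᵇ K)

-- Special points of sort 𝒦: simple functions  Σ_j a_j χ_{J_j},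
-- coded as a list of (generated point a_j , region J_j)
SimpleFn : {L : Language} → Structure L → Set
SimpleFn {L} M = List (GTerm M × Region)

hits : {A : Set} → List (A × Region) → ℚ → ℕ
hits [] ω = zero
hits ((_ , J) ∷ fs) ω = if ω ∈ᵇ J then suc (hits fs ω) else hits fs ω

-- well-formedness: the J_j are pairwise disjoint and cover [0,1)
ValidSimple : {L : Language} {M : Structure L} → SimpleFn M → Set
ValidSimple f = (ω : ℚ) → 0ℚ ≤ ω → ω < 1ℚ → hits f ω ≡ 1

-- value of a simple function at ω (the term of the region containing ω;
-- the default is irrelevant for valid codes and points of [0,1))
valueAt : {A : Set} → A → List (A × Region) → ℚ → A
valueAt d [] ω = d
valueAt d ((a , J) ∷ fs) ω = if ω ∈ᵇ J then a else valueAt d fs ω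

-- ⟦φ(f⃗)⟧ as a predicate on (rational) points ω
Denot : {L : Language} (M : Structure L) (P : Presentation M) {n : ℕ} →
        QF L n → Vec (SimpleFn M) n → ℚ → Set
Denot M P φ fs ω =
  Sat M φ (λ i → evalT M gen (valueAt (var 0) (lookup fs i) ω))
  where open Presentation P

-- Lebesgue measure of a subset of [0,1) that is a finite union of
-- intervals [b_i , b_{i+1}) with rational endpoints.

Chain : ℚ → List ℚ → Set
Chain a []       = a ≡ 1ℚ
Chain a (b ∷ bs) = (a < b) × Chain b bs

AllIn AllOut : (ℚ → Set) → ℚ → ℚ → Set
AllIn  S a b = (ω : ℚ) → a ≤ ω → ω < b → S ω
AllOut S a b = (ω : ℚ) → a ≤ ω → ω < b → ¬ S ω

-- S is, on each cell [b_i,b_{i+1}), either full or empty, and r is the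
-- total length of the full cells
MeasureOn : (ℚ → Set) → ℚ → List ℚ → ℚ → Set
MeasureOn S a []       r = r ≡ 0ℚ
MeasureOn S a (b ∷ bs) r =
    (AllIn  S a b × MeasureOn S b bs (r - (b - a)))
  ⊎ (AllOut S a b × MeasureOn S b bs r)

HasMeasure : (ℚ → Set) → ℚ → Set
HasMeasure S r = ∃ λ bs → Chain 0ℚ bs × MeasureOn S 0ℚ bs r

-- φ is computable w.r.t. the induced presentation of the randomization:
-- an algorithm A (f⃗ , ε) ↦ q with |μ⟦φ(f⃗)⟧ - q| < ε for valid special f⃗
-- and rational ε > 0.

ComputableFormula : {L : Language} (M : Structure L) (P : Presentation M) {n : ℕ} →
                    QF L n → Set
ComputableFormula M P {n} φ =
  Σ (Vec (SimpleFn M) n → ℚ → ℚ) λ A →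
    (fs : Vec (SimpleFn M) n) →
    ((i : Fin n) → ValidSimple {M = M} (lookup fs i)) →
    (ε : ℚ) → 0ℚ < ε →
    ∃ λ r → HasMeasure (Denot M P φ fs) r × (∣ r - A fs ε ∣ < ε)

{-# OPTIONS --safe #-}
module Submission where

open import Defs
open import Data.Nat using (ℕ)
open import Data.Fin using (Fin; zero; suc)
open import Data.Vec using (Vec; []; _∷_; lookup)
open import Data.List using (List; []; _∷_; _++_)
open import Data.List.Relation.Unary.All using (All; []; _∷_)
open import Data.List.Relation.Unary.All.Properties using (++⁻ˡ; ++⁻ʳ)
import Data.List.Relation.Unary.All as All
open import Data.Bool using (true; false; T; _∧_; _∨_; not; if_then_else_)
open import Data.Bool.Properties using (T-≡)
open import Data.Product using (Σ; _×_; _,_; ∃; proj₁; proj₂)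
import Data.Product as Product
open import Data.Sum using (_⊎_; inj₁; inj₂)
import Data.Sum as Sum
open import Data.Unit using (⊤; tt)
open import Data.Rational using (ℚ; 0ℚ; 1ℚ; _≤_; _<_; _-_; _+_; _≤ᵇ_; ∣_∣)
open import Data.Rational.Properties
  using (≤-refl; ≤-trans; <⇒≤; ≤-<-trans; <-≤-trans; <-irrefl; ≮⇒≥; _<?_;
         ≤⇒≤ᵇ; ≤ᵇ⇒≤; +-inverseʳ; +-0-abelianGroup)
open import Algebra.Properties.AbelianGroup +-0-abelianGroup using (xyx⁻¹≈y)
open import Function using (_∘_; id; _⇔_; mk⇔; Equivalence)
open import Relation.Nullary using (Dec; yes; no; contradiction)
open import Relation.Nullary.Decidable using (from-yes; map′; ¬?; _×-dec_; _⊎-dec_; _→-dec_)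
open import Relation.Binary.PropositionalEquality
  using (_≡_; refl; sym; trans; cong; cong₂; subst; subst₂; _≗_)

-- Cut [0,1) at every endpoint of every interval occurring in the codes f⃗.
-- On each resulting cell [b, b') all the f_i are constant, hence so is the
-- truth value of φ(f⃗(ω)); it is decided at ω = b by substituting the
-- generated terms f_i(b) into φ and using decidability of atomic formulas in
-- 𝓜^#.  Summing the lengths of the cells where φ holds gives μ⟦φ(f⃗)⟧ exactly.

module _ {L : Language} (M : Structure L) where
  open Language L
  open Structure M

  mutual
    substT : {V W : Set} → (V → Term L W) → Term L V → Term L W
    substT σ (var v)    = σ v
    substT σ (app F ts) = app F (substTs σ ts)

    substTs : {V W : Set} {k : ℕ} → (V → Term L W) → Vec (Term L V) k → Vec (Term L W) k
    substTs σ []       = []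
    substTs σ (t ∷ ts) = substT σ t ∷ substTs σ ts

  mutual
    evalT-subst : {V W : Set} (ρ : W → Carrier) (σ : V → Term L W) (t : Term L V) →
                  evalT M (evalT M ρ ∘ σ) t ≡ evalT M ρ (substT σ t)
    evalT-subst ρ σ (var v)    = refl
    evalT-subst ρ σ (app F ts) = cong (funI F) (evalTs-subst ρ σ ts)

    evalTs-subst : {V W : Set} {k : ℕ} (ρ : W → Carrier) (σ : V → Term L W)
                   (ts : Vec (Term L V) k) →
                   evalTs M (evalT M ρ ∘ σ) ts ≡ evalTs M ρ (substTs σ ts)
    evalTs-subst ρ σ []       = refl
    evalTs-subst ρ σ (t ∷ ts) = cong₂ _∷_ (evalT-subst ρ σ t) (evalTs-subst ρ σ ts)

  mutual
    evalT-cong : {V : Set} {ρ ρ′ : V → Carrier} → ρ ≗ ρ′ → (t : Term L V) →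
                 evalT M ρ t ≡ evalT M ρ′ t
    evalT-cong e (var v)    = e v
    evalT-cong e (app F ts) = cong (funI F) (evalTs-cong e ts)

    evalTs-cong : {V : Set} {k : ℕ} {ρ ρ′ : V → Carrier} → ρ ≗ ρ′ →
                  (ts : Vec (Term L V) k) → evalTs M ρ ts ≡ evalTs M ρ′ ts
    evalTs-cong e []       = refl
    evalTs-cong e (t ∷ ts) = cong₂ _∷_ (evalT-cong e t) (evalTs-cong e ts)

  Sat-resp : {n : ℕ} (φ : QF L n) {ρ ρ′ : Fin n → Carrier} → ρ ≗ ρ′ →
             Sat M φ ρ → Sat M φ ρ′
  Sat-resp qtrue      e = id
  Sat-resp qfalse     e = id
  Sat-resp (eq s t)   e = subst₂ _≡_ (evalT-cong e s) (evalT-cong e t)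
  Sat-resp (rel R ts) e = subst (relI R) (evalTs-cong e ts)
  Sat-resp (neg φ)    e = λ ¬p → ¬p ∘ Sat-resp φ (sym ∘ e)
  Sat-resp (conj φ ψ) e = Product.map (Sat-resp φ e) (Sat-resp ψ e)
  Sat-resp (disj φ ψ) e = Sum.map (Sat-resp φ e) (Sat-resp ψ e)
  Sat-resp (impl φ ψ) e = λ h → Sat-resp ψ e ∘ h ∘ Sat-resp φ (sym ∘ e)

  module _ {P : Presentation M} (C : Computable M P) where
    open Presentation P
    open Computable C

    sat? : {n : ℕ} (φ : QF L n) (t : Fin n → GTerm M) → Dec (Sat M φ (evalT M gen ∘ t))
    sat? qtrue      t = yes tt
    sat? qfalse     t = no id
    sat? (eq s u)   t = map′ (subst₂ _≡_ (sym es) (sym eu)) (subst₂ _≡_ es eu)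
                             (decEq (substT t s) (substT t u))
      where
      es : evalT M (evalT M gen ∘ t) s ≡ evalT M gen (substT t s)
      es = evalT-subst gen t s
      eu : evalT M (evalT M gen ∘ t) u ≡ evalT M gen (substT t u)
      eu = evalT-subst gen t u
    sat? (rel R ts) t = map′ (subst (relI R) (sym e)) (subst (relI R) e)
                             (decRel R (substTs t ts))
      where
      e : evalTs M (evalT M gen ∘ t) ts ≡ evalTs M gen (substTs t ts)
      e = evalTs-subst gen t ts
    sat? (neg φ)    t = ¬? (sat? φ t)
    sat? (conj φ ψ) t = sat? φ t ×-dec sat? ψ t
    sat? (disj φ ψ) t = sat? φ t ⊎-dec sat? ψ t
    sat? (impl φ ψ) t = sat? φ t →-dec sat? ψ t

Uncut : List ℚ → ℚ → ℚ → Set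
Uncut cs x y = All (λ c → c ≤ x ⊎ y ≤ c) cs

Uncut-shrink : {cs : List ℚ} {x x′ y y′ : ℚ} → x ≤ x′ → y′ ≤ y → Uncut cs x y → Uncut cs x′ y′
Uncut-shrink x≤x′ y′≤y = All.map (Sum.map (λ c≤x → ≤-trans c≤x x≤x′) (≤-trans y′≤y))

AllCells : (ℚ → ℚ → Set) → ℚ → List ℚ → Set
AllCells P a []       = ⊤
AllCells P a (b ∷ bs) = P a b × AllCells P b bs

AllCells-map : {P Q : ℚ → ℚ → Set} → (∀ {x y} → P x y → Q x y) →
               {a : ℚ} (bs : List ℚ) → AllCells P a bs → AllCells Q a bs
AllCells-map f []       tt       = tt
AllCells-map f (b ∷ bs) (p , ps) = f p , AllCells-map f bs ps

insertCut : ℚ → ℚ → List ℚ → List ℚ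
insertCut c a []       = []
insertCut c a (b ∷ bs) with a <? c | c <? b
... | yes _ | yes _ = c ∷ b ∷ insertCut c b bs
... | yes _ | no  _ = b ∷ insertCut c b bs
... | no  _ | _     = b ∷ insertCut c b bs

insertCut-chain : (c a : ℚ) (bs : List ℚ) → Chain a bs → Chain a (insertCut c a bs)
insertCut-chain c a []       a≡1        = a≡1
insertCut-chain c a (b ∷ bs) (a<b , ch) with a <? c | c <? b
... | yes a<c | yes c<b = a<c , c<b , insertCut-chain c b bs ch
... | yes _   | no  _   = a<b , insertCut-chain c b bs ch
... | no  _   | _       = a<b , insertCut-chain c b bs ch

insertCut-uncut : {cs : List ℚ} (c a : ℚ) (bs : List ℚ) → AllCells (Uncut cs) a bs →
                  AllCells (Uncut (c ∷ cs)) a (insertCut c a bs)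
insertCut-uncut c a []       tt       = tt
insertCut-uncut c a (b ∷ bs) (u , us) with a <? c | c <? b
... | yes a<c | yes c<b = (inj₂ ≤-refl ∷ Uncut-shrink ≤-refl (<⇒≤ c<b) u)
                        , (inj₁ ≤-refl ∷ Uncut-shrink (<⇒≤ a<c) ≤-refl u)
                        , insertCut-uncut c b bs us
... | yes _   | no c≮b  = (inj₂ (≮⇒≥ c≮b) ∷ u) , insertCut-uncut c b bs us
... | no a≮c  | _       = (inj₁ (≮⇒≥ a≮c) ∷ u) , insertCut-uncut c b bs us

partitionBy : List ℚ → List ℚ
partitionBy []       = 1ℚ ∷ []
partitionBy (c ∷ cs) = insertCut c 0ℚ (partitionBy cs)

partitionBy-chain : (cs : List ℚ) → Chain 0ℚ (partitionBy cs)
partitionBy-chain []       = from-yes (0ℚ <? 1ℚ) , refl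
partitionBy-chain (c ∷ cs) = insertCut-chain c 0ℚ (partitionBy cs) (partitionBy-chain cs)

partitionBy-uncut : (cs : List ℚ) → AllCells (Uncut cs) 0ℚ (partitionBy cs)
partitionBy-uncut []       = [] , tt
partitionBy-uncut (c ∷ cs) = insertCut-uncut c 0ℚ (partitionBy cs) (partitionBy-uncut cs)

Homogeneous : (ℚ → Set) → ℚ → ℚ → Set
Homogeneous S x y = AllIn S x y ⊎ AllOut S x y

homogeneous : {S : ℚ → Set} {x y : ℚ} → Dec (S x) →
              (∀ {ω} → x ≤ ω → ω < y → S x ⇔ S ω) → Homogeneous S x y
homogeneous (yes s)  const = inj₁ λ ω x≤ω ω<y → Equivalence.to (const x≤ω ω<y) s
homogeneous (no ¬s)  const = inj₂ λ ω x≤ω ω<y → ¬s ∘ Equivalence.from (const x≤ω ω<y)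

measureOn-homogeneous : {S : ℚ → Set} {a : ℚ} (bs : List ℚ) →
                        AllCells (Homogeneous S) a bs → ∃ (MeasureOn S a bs)
measureOn-homogeneous []       tt = 0ℚ , refl
measureOn-homogeneous {S} {a} (b ∷ bs) (h , hs) with measureOn-homogeneous bs hs | h
... | r , m | inj₁ full  = (b - a) + r
                         , inj₁ (full , subst (MeasureOn S b bs) (sym (xyx⁻¹≈y (b - a) r)) m)
... | r , m | inj₂ empty = r , inj₂ (empty , m)

≤ᵇ-true : {p q : ℚ} → p ≤ q → (p ≤ᵇ q) ≡ true
≤ᵇ-true p≤q = Equivalence.to T-≡ (≤⇒≤ᵇ p≤q)

≤ᵇ-false : {p q : ℚ} → q < p → (p ≤ᵇ q) ≡ false
≤ᵇ-false {p} {q} q<p with p ≤ᵇ q in e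
... | false = refl
... | true  = contradiction (≤-<-trans (≤ᵇ⇒≤ (subst T (sym e) tt)) q<p) (<-irrefl refl)

≤ᵇ-constant : {c x y ω : ℚ} → c ≤ x ⊎ y ≤ c → x ≤ ω → ω < y → (c ≤ᵇ ω) ≡ (c ≤ᵇ x)
≤ᵇ-constant (inj₁ c≤x) x≤ω ω<y = trans (≤ᵇ-true (≤-trans c≤x x≤ω)) (sym (≤ᵇ-true c≤x))
≤ᵇ-constant (inj₂ y≤c) x≤ω ω<y =
  trans (≤ᵇ-false (<-≤-trans ω<y y≤c)) (sym (≤ᵇ-false (≤-<-trans x≤ω (<-≤-trans ω<y y≤c))))

endpoints : Region → List ℚ
endpoints (ival p q)   = p ∷ q ∷ []
endpoints (rcomp J)    = endpoints J
endpoints (rinter J K) = endpoints J ++ endpoints K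
endpoints (runion J K) = endpoints J ++ endpoints K

∈ᵇ-constant : (J : Region) {x y ω : ℚ} → Uncut (endpoints J) x y → x ≤ ω → ω < y →
              (ω ∈ᵇ J) ≡ (x ∈ᵇ J)
∈ᵇ-constant (ival p q)   (up ∷ uq ∷ []) x≤ω ω<y =
  cong₂ (λ u v → u ∧ not v) (≤ᵇ-constant up x≤ω ω<y) (≤ᵇ-constant uq x≤ω ω<y)
∈ᵇ-constant (rcomp J)    u x≤ω ω<y = cong not (∈ᵇ-constant J u x≤ω ω<y)
∈ᵇ-constant (rinter J K) u x≤ω ω<y =
  cong₂ _∧_ (∈ᵇ-constant J (++⁻ˡ (endpoints J) u) x≤ω ω<y)
            (∈ᵇ-constant K (++⁻ʳ (endpoints J) u) x≤ω ω<y)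
∈ᵇ-constant (runion J K) u x≤ω ω<y =
  cong₂ _∨_ (∈ᵇ-constant J (++⁻ˡ (endpoints J) u) x≤ω ω<y)
            (∈ᵇ-constant K (++⁻ʳ (endpoints J) u) x≤ω ω<y)

breakpoints : {A : Set} → List (A × Region) → List ℚ
breakpoints []             = []
breakpoints ((_ , J) ∷ fs) = endpoints J ++ breakpoints fs

valueAt-constant : {A : Set} (d : A) (f : List (A × Region)) {x y ω : ℚ} →
                   Uncut (breakpoints f) x y → x ≤ ω → ω < y → valueAt d f ω ≡ valueAt d f x
valueAt-constant d []            u x≤ω ω<y = refl
valueAt-constant d ((a , J) ∷ f) u x≤ω ω<y =
  cong₂ (λ b v → if b then a else v)
        (∈ᵇ-constant J (++⁻ˡ (endpoints J) u) x≤ω ω<y)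
        (valueAt-constant d f (++⁻ʳ (endpoints J) u) x≤ω ω<y)

breakpointsᵛ : {A : Set} {n : ℕ} → Vec (List (A × Region)) n → List ℚ
breakpointsᵛ []       = []
breakpointsᵛ (f ∷ fs) = breakpoints f ++ breakpointsᵛ fs

breakpointsᵛ-lookup : {A : Set} {n : ℕ} (fs : Vec (List (A × Region)) n) (i : Fin n) {x y : ℚ} →
                      Uncut (breakpointsᵛ fs) x y → Uncut (breakpoints (lookup fs i)) x y
breakpointsᵛ-lookup (f ∷ fs) zero    u = ++⁻ˡ (breakpoints f) u
breakpointsᵛ-lookup (f ∷ fs) (suc i) u = breakpointsᵛ-lookup fs i (++⁻ʳ (breakpoints f) u)

module _ {L : Language} {M : Structure L} {P : Presentation M} where
  open Presentation P

  Denot-constant : {n : ℕ} (φ : QF L n) (fs : Vec (SimpleFn M) n) {x y ω : ℚ} →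
                   Uncut (breakpointsᵛ fs) x y → x ≤ ω → ω < y →
                   Denot M P φ fs x ⇔ Denot M P φ fs ω
  Denot-constant φ fs {x = x} {ω = ω} u x≤ω ω<y = mk⇔ (Sat-resp M φ same) (Sat-resp M φ (sym ∘ same))
    where
    same : (λ i → evalT M gen (valueAt (var 0) (lookup fs i) x)) ≗
           (λ i → evalT M gen (valueAt (var 0) (lookup fs i) ω))
    same i = cong (evalT M gen)
                  (sym (valueAt-constant (var 0) (lookup fs i) (breakpointsᵛ-lookup fs i u) x≤ω ω<y))

  Denot-measure : Computable M P → {n : ℕ} (φ : QF L n) (fs : Vec (SimpleFn M) n) →
                  Σ ℚ (HasMeasure (Denot M P φ fs))
  Denot-measure C φ fs = proj₁ measured , partitionBy cs , partitionBy-chain cs , proj₂ measured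
    where
    cs : List ℚ
    cs = breakpointsᵛ fs

    homogeneous-cell : {x y : ℚ} → Uncut cs x y → Homogeneous (Denot M P φ fs) x y
    homogeneous-cell {x} u =
      homogeneous (sat? M C φ (λ i → valueAt (var 0) (lookup fs i) x)) (Denot-constant φ fs u)

    measured : ∃ (MeasureOn (Denot M P φ fs) 0ℚ (partitionBy cs))
    measured = measureOn-homogeneous (partitionBy cs)
                 (AllCells-map homogeneous-cell (partitionBy cs) (partitionBy-uncut cs))

-- The measure is computed exactly.
mainTheorem10 : (L : Language) (M : Structure L) (P : Presentation M) →
    Computable M P →
    (n : ℕ) (φ : QF L n) → ComputableFormula M P φ
mainTheorem10 L M P C n φ = (λ fs _ → μ fs) , λ fs _ ε ε>0 → μ fs , hasMeasure fs , exact (μ fs) ε>0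
  where
  μ : Vec (SimpleFn M) n → ℚ
  μ fs = proj₁ (Denot-measure C φ fs)

  hasMeasure : (fs : Vec (SimpleFn M) n) → HasMeasure (Denot M P φ fs) (μ fs)
  hasMeasure fs = proj₂ (Denot-measure C φ fs)

  exact : (r : ℚ) {ε : ℚ} → 0ℚ < ε → ∣ r - r ∣ < ε
  exact r = subst (_< _) (sym (cong ∣_∣ (+-inverseʳ r)))
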